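{- Let $G$ be a graph of order $n\ge 1$. Then $$\frac{n^2+n+2}{2}\le d(G)\le 2^n.$$ The left equality holds if and only if $G\cong K_{n_1,n_2,\ldots,n_k}$ is a complete multipartite graph with $n_i\le 2$ for all $1\le i\le k$ and $n_1+\cdots+n_k=n$. The right equality holds if and only if $G\cong sK_1\cup tK_2$, a disjoint union of $s$ isolated vertices and $t$ disjoint edges, with $s+2t=n$.
   Context: All graphs are finite, simple and undirected. A subset $D\subseteq V(G)$ is a dissociation set of $G$ if the induced subgraph $G[D]$ has maximum degree at most $1$; the empty set is a dissociation set. $d(G)$ denotes the total number of dissociation sets of $G$, including the empty set. In particular, the graph with no vertices has $d=1$. -}

module Defs where

open import Data.Fin.Base using (Fin; zero; suc)
import Data.Fin.Properties as Fin
open import Data.Fin.Subset using (Subset; inside; outside; ∣_∣)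
open import Data.List.Base as List using (List; _++_; filter; length)
open import Data.Nat.Base using (ℕ; zero; suc; _≤_; _⊔_)
open import Data.Nat.Properties using (_≤?_)
open import Data.Product.Base using (Σ-syntax; _×_; _,_; proj₁)
open import Data.Product.Relation.Binary.Pointwise.NonDependent as ×
  using (×-decidable)
open import Data.Sum.Base using (_⊎_)
open import Data.Sum.Relation.Binary.Pointwise as ⊎
  using (⊎-symmetric; ⊎-decidable)
open import Data.Vec.Base as Vec using (Vec; []; _∷_; lookup)
open import Function.Base using (_on_)
open import Function.Bundles using (_↔_; _⇔_; Inverse)
open import Level using (0ℓ)
open import Relation.Binary.Core using (Rel)
open import Relation.Binary.Definitions using (Symmetric; Decidable)
open import Relation.Binary.PropositionalEquality
  using (_≡_; _≢_; refl; sym; ≢-sym)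
open import Relation.Nullary using (¬_)
open import Relation.Nullary.Decidable using (¬?)
import Relation.Unary as U

-- A simple undirected graph on V with decidable adjacency.  A finite graph
-- of order n is an element of Graph (Fin n); other vertex types only serve
-- to describe the named families up to isomorphism.
record Graph (V : Set) : Set₁ where
  field
    Adj     : Rel V 0ℓ
    adj?    : Decidable Adj
    adj-sym : Symmetric Adj
    loopless : ∀ {v} → ¬ Adj v v

open Graph

infix 4 _≅_

_≅_ : ∀ {V W} → Graph V → Graph W → Set
_≅_ {V} {W} G H =
  Σ[ f ∈ V ↔ W ] (∀ u v → Adj G u v ⇔ Adj H (Inverse.to f u) (Inverse.to f v))

degree : ∀ {n} → Graph (Fin n) → Fin n → ℕ
degree {n} G v = Vec.count (adj? G v) (Vec.allFin n)

-- The graph without vertices gets maximum degree 0.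
maxDegree : ∀ {n} → Graph (Fin n) → ℕ
maxDegree {n} G = Vec.foldr′ _⊔_ 0 (Vec.map (degree G) (Vec.allFin n))

-- The members of D in increasing order, each once.
elements : ∀ {n} (D : Subset n) → Vec (Fin n) ∣ D ∣
elements []            = []
elements (inside ∷ D)  = zero ∷ Vec.map suc (elements D)
elements (outside ∷ D) = Vec.map suc (elements D)

-- The induced subgraph, with vertex i standing for the i-th member of D.
infix 8 _[_]

_[_] : ∀ {n} → Graph (Fin n) → (D : Subset n) → Graph (Fin ∣ D ∣)
G [ D ] = record
  { Adj      = Adj G on lookup (elements D)
  ; adj?     = λ i j → adj? G (lookup (elements D) i) (lookup (elements D) j)
  ; adj-sym  = adj-sym G
  ; loopless = loopless G
  }

Dissociation : ∀ {n} → Graph (Fin n) → Subset n → Set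
Dissociation G D = maxDegree (G [ D ]) ≤ 1

dissociation? : ∀ {n} (G : Graph (Fin n)) → U.Decidable (Dissociation G)
dissociation? G D = maxDegree (G [ D ]) ≤? 1

-- Every subset of Fin n, each once.
subsets : ∀ n → List (Subset n)
subsets zero    = List.[ [] ]
subsets (suc n) =
  List.map (inside ∷_) (subsets n) ++ List.map (outside ∷_) (subsets n)

d : ∀ {n} → Graph (Fin n) → ℕ
d {n} G = length (filter (dissociation? G) (subsets n))

K : ∀ n → Graph (Fin n)
K n = record
  { Adj      = _≢_
  ; adj?     = λ u v → ¬? (u Fin.≟ v)
  ; adj-sym  = ≢-sym
  ; loopless = λ v≢v → v≢v refl
  }

-- A vertex is a pair of a part i and a position in that part.
completeMultipartite : ∀ {k} (ns : Vec ℕ k) →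
                       Graph (Σ[ i ∈ Fin k ] Fin (lookup ns i))
completeMultipartite ns = record
  { Adj      = _≢_ on proj₁
  ; adj?     = λ u v → ¬? (proj₁ u Fin.≟ proj₁ v)
  ; adj-sym  = ≢-sym
  ; loopless = λ v≢v → v≢v refl
  }

infixr 6 _∪_

-- Disjoint union.
_∪_ : ∀ {V W} → Graph V → Graph W → Graph (V ⊎ W)
G ∪ H = record
  { Adj      = ⊎.Pointwise (Adj G) (Adj H)
  ; adj?     = ⊎-decidable (adj? G) (adj? H)
  ; adj-sym  = ⊎-symmetric (adj-sym G) (adj-sym H)
  ; loopless = ∪-loopless
  }
  where
  ∪-loopless : ∀ {v} → ¬ ⊎.Pointwise (Adj G) (Adj H) v v
  ∪-loopless (⊎.inj₁ e) = loopless G e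
  ∪-loopless (⊎.inj₂ e) = loopless H e

infixr 7 _∙_

-- The disjoint union of m copies of G.
_∙_ : ∀ {V} (m : ℕ) → Graph V → Graph (Fin m × V)
m ∙ G = record
  { Adj      = ×.Pointwise _≡_ (Adj G)
  ; adj?     = ×-decidable Fin._≟_ (adj? G)
  ; adj-sym  = λ (i≡j , e) → sym i≡j , adj-sym G e
  ; loopless = λ (_ , e) → loopless G e
  }

{-# OPTIONS --safe #-}

-- Call a graph a matching if each vertex has at most one neighbour.  D is a
-- dissociation set of G iff G [ D ] is a matching, so all 2 ^ n subsets are
-- dissociation sets iff G is a matching.  Every set of size at most 2 is a
-- dissociation set, which gives the lower bound.  It is attained iff no
-- dissociation set has three members, that is, iff every three vertices carry
-- at least two edges, that is, iff the complement of G is a matching.  A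
-- matching is a disjoint union of copies of K 1 and K 2, and the complement of
-- such a union is complete multipartite with parts of size at most 2.
module Submission where

open import Defs
open import Data.Bool.Base using (true; false)
open import Data.Empty using (⊥-elim)
open import Data.Fin.Base using (Fin; zero; suc; punchIn; punchOut)
import Data.Fin.Properties as Fin
open import Data.Fin.Subset as Subset using (Subset; inside; outside; ∣_∣; ⁅_⁆)
open import Data.Fin.Subset.Properties using (∈⊤; x∈⁅x⁆; x∈⁅y⁆⇒x≡y; x∈p∪q⁺; x∈p∪q⁻)
open import Data.List.Base as List using (List; []; _∷_; _++_; filter; length)
open import Data.List.Membership.Propositional as List using ()
open import Data.List.Membership.Propositional.Properties
  using (∈-filter⁺; ∈-filter⁻; ∈-map⁺; ∈-++⁺ˡ; ∈-++⁺ʳ)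
open import Data.List.Properties
  using (filter-++; filter-≐; length-++; length-map; filter-none)
open import Data.List.Relation.Binary.Equality.Propositional using (≋⇒≡)
open import Data.List.Relation.Binary.Sublist.Propositional using (_⊆_; ⊆-refl)
open import Data.List.Relation.Binary.Sublist.Propositional.Properties
  using (filter⁺; length-mono-≤; to-≋)
import Data.List.Relation.Unary.All as All
import Data.List.Relation.Unary.Any as Any
open import Data.Nat.Base using (ℕ; zero; suc; _+_; _*_; _^_; _≤_; _⊔_; z≤n; s≤s)
open import Data.Nat.DivMod using (_/_; m*n/n≡m)
open import Data.Nat.Properties
  using (_≤?_; ≤-refl; ≤-trans; ≤-reflexive; m≤m⊔n; m≤n⊔m; ⊔-lub;
         +-identityʳ; *-distribʳ-+)
open import Data.Nat.Tactic.RingSolver using (solve-∀)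
open import Data.Product.Base using (_×_; _,_; proj₁; proj₂; ∃-syntax; Σ-syntax)
import Data.Product.Properties as Product
open import Data.Sum.Base as Sum using (_⊎_; inj₁; inj₂)
open import Data.Sum.Relation.Binary.Pointwise as ⊎ using ()
open import Data.Unit.Base using (⊤; tt)
open import Data.Vec.Base as Vec using (Vec; []; _∷_; lookup; sum; here; there)
open import Data.Vec.Properties using (lookup-allFin; lookup-map)
open import Function.Base using (_∘_; id)
open import Function.Bundles using (_⇔_; mk⇔; mk↔ₛ′; Inverse; Equivalence)
open import Relation.Binary.Definitions using (DecidableEquality)
open import Relation.Binary.PropositionalEquality
  using (_≡_; _≢_; refl; sym; trans; cong; cong₂; subst; subst₂; ≢-sym; module ≡-Reasoning)
open import Relation.Nullary using (¬_; Dec; does; yes; no; contradiction)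
open import Relation.Nullary.Decidable using (¬?; _×-dec_; decidable-stable)
import Relation.Unary as U

open Graph

-- Isomorphisms

infix 4 _≃_

-- Unlike _≅_, which unfolds, this record determines G and H by unification.
record _≃_ {V W : Set} (G : Graph V) (H : Graph W) : Set where
  constructor mk≃
  field
    to       : V → W
    from     : W → V
    to-from  : ∀ y → to (from y) ≡ y
    from-to  : ∀ x → from (to x) ≡ x
    to-adj   : ∀ u v → Adj G u v → Adj H (to u) (to v)
    from-adj : ∀ u v → Adj H u v → Adj G (from u) (from v)

  to-injective : ∀ {u v} → to u ≡ to v → u ≡ v
  to-injective p = trans (sym (from-to _)) (trans (cong from p) (from-to _))

  from-injective : ∀ {u v} → from u ≡ from v → u ≡ v
  from-injective p = trans (sym (to-from _)) (trans (cong to p) (to-from _))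

module _ {V W} {G : Graph V} {H : Graph W} where

  ≃⇒≅ : G ≃ H → G ≅ H
  ≃⇒≅ e = mk↔ₛ′ to from to-from from-to , λ u v →
    mk⇔ (to-adj u v) (subst₂ (Adj G) (from-to u) (from-to v) ∘ from-adj (to u) (to v))
    where open _≃_ e

  ≅⇒≃ : G ≅ H → G ≃ H
  ≅⇒≃ (f , adj) = mk≃ to from strictlyInverseˡ strictlyInverseʳ
    (λ u v → Equivalence.to (adj u v))
    (λ x y → Equivalence.from (adj (from x) (from y)) ∘
      subst₂ (Adj H) (sym (strictlyInverseˡ x)) (sym (strictlyInverseˡ y)))
    where open Inverse f using (to; from; strictlyInverseˡ; strictlyInverseʳ)

≃-refl : ∀ {V} {G : Graph V} → G ≃ G
≃-refl = mk≃ id id (λ _ → refl) (λ _ → refl) (λ _ _ → id) (λ _ _ → id)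

≃-sym : ∀ {V W} {G : Graph V} {H : Graph W} → G ≃ H → H ≃ G
≃-sym e = mk≃ from to from-to to-from from-adj to-adj
  where open _≃_ e

≃-trans : ∀ {U V W} {G : Graph U} {H : Graph V} {I : Graph W} →
          G ≃ H → H ≃ I → G ≃ I
≃-trans e e′ = mk≃ (F.to ∘ E.to) (E.from ∘ F.from)
  (λ y → trans (cong F.to (E.to-from _)) (F.to-from y))
  (λ x → trans (cong E.from (F.from-to _)) (E.from-to x))
  (λ u v → F.to-adj _ _ ∘ E.to-adj u v)
  (λ u v → E.from-adj _ _ ∘ F.from-adj u v)
  where
  module E = _≃_ e
  module F = _≃_ e′

empty-≃ : ∀ {V W} {G : Graph V} {H : Graph W} → ¬ V → ¬ W → G ≃ H
empty-≃ ¬v ¬w = mk≃ (⊥-elim ∘ ¬v) (⊥-elim ∘ ¬w) (⊥-elim ∘ ¬w) (⊥-elim ∘ ¬v)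
  (λ u → ⊥-elim (¬v u)) (λ u → ⊥-elim (¬w u))

∪-cong : ∀ {A B C D} {G : Graph A} {G′ : Graph B} {H : Graph C} {H′ : Graph D} →
         G ≃ G′ → H ≃ H′ → G ∪ H ≃ G′ ∪ H′
∪-cong e e′ = mk≃ (Sum.map E.to F.to) (Sum.map E.from F.from)
  (λ { (inj₁ y) → cong inj₁ (E.to-from y)
     ; (inj₂ y) → cong inj₂ (F.to-from y) })
  (λ { (inj₁ x) → cong inj₁ (E.from-to x)
     ; (inj₂ x) → cong inj₂ (F.from-to x) })
  (λ _ _ → ⊎.map (E.to-adj _ _) (F.to-adj _ _))
  (λ _ _ → ⊎.map (E.from-adj _ _) (F.from-adj _ _))
  where
  module E = _≃_ e
  module F = _≃_ e′

∪-assoc : ∀ {A B C} {G : Graph A} {H : Graph B} {I : Graph C} →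
          (G ∪ H) ∪ I ≃ G ∪ (H ∪ I)
∪-assoc = mk≃ Sum.assocʳ Sum.assocˡ
  (λ { (inj₁ _) → refl ; (inj₂ (inj₁ _)) → refl ; (inj₂ (inj₂ _)) → refl })
  (λ { (inj₁ (inj₁ _)) → refl ; (inj₁ (inj₂ _)) → refl ; (inj₂ _) → refl })
  (λ { _ _ (⊎.inj₁ (⊎.inj₁ e)) → ⊎.inj₁ e
     ; _ _ (⊎.inj₁ (⊎.inj₂ e)) → ⊎.inj₂ (⊎.inj₁ e)
     ; _ _ (⊎.inj₂ e) → ⊎.inj₂ (⊎.inj₂ e) })
  (λ { _ _ (⊎.inj₁ e) → ⊎.inj₁ (⊎.inj₁ e)
     ; _ _ (⊎.inj₂ (⊎.inj₁ e)) → ⊎.inj₁ (⊎.inj₂ e)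
     ; _ _ (⊎.inj₂ (⊎.inj₂ e)) → ⊎.inj₂ e })

∪-comm : ∀ {A B} {G : Graph A} {H : Graph B} → G ∪ H ≃ H ∪ G
∪-comm = mk≃ Sum.swap Sum.swap
  (λ { (inj₁ _) → refl ; (inj₂ _) → refl })
  (λ { (inj₁ _) → refl ; (inj₂ _) → refl })
  (λ { _ _ (⊎.inj₁ e) → ⊎.inj₂ e ; _ _ (⊎.inj₂ e) → ⊎.inj₁ e })
  (λ { _ _ (⊎.inj₁ e) → ⊎.inj₂ e ; _ _ (⊎.inj₂ e) → ⊎.inj₁ e })

∙-suc : ∀ {V} (m : ℕ) (G : Graph V) → G ∪ (m ∙ G) ≃ suc m ∙ G
∙-suc m G = mk≃
  (λ { (inj₁ v) → zero , v ; (inj₂ (i , v)) → suc i , v })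
  (λ { (zero , v) → inj₁ v ; (suc i , v) → inj₂ (i , v) })
  (λ { (zero , _) → refl ; (suc _ , _) → refl })
  (λ { (inj₁ _) → refl ; (inj₂ _) → refl })
  (λ { _ _ (⊎.inj₁ e) → refl , e ; _ _ (⊎.inj₂ (refl , e)) → refl , e })
  (λ { (zero , _) _ (refl , e) → ⊎.inj₁ e ; (suc _ , _) _ (refl , e) → ⊎.inj₂ (refl , e) })

-- Complements

complement : ∀ {V} → DecidableEquality V → Graph V → Graph V
complement _≟_ G = record
  { Adj      = λ u v → u ≢ v × ¬ Adj G u v
  ; adj?     = λ u v → ¬? (u ≟ v) ×-dec ¬? (adj? G u v)
  ; adj-sym  = λ (u≢v , ¬uv) → ≢-sym u≢v , ¬uv ∘ adj-sym G
  ; loopless = λ (v≢v , _) → v≢v refl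
  }

complement-cong : ∀ {V W} (_≟_ : DecidableEquality V) (_≟′_ : DecidableEquality W)
                  {G : Graph V} {H : Graph W} →
                  G ≃ H → complement _≟_ G ≃ complement _≟′_ H
complement-cong _ _ {G} {H} e = mk≃ to from to-from from-to
  (λ u v (u≢v , ¬uv) → u≢v ∘ to-injective ,
    ¬uv ∘ subst₂ (Adj G) (from-to u) (from-to v) ∘ from-adj _ _)
  (λ x y (x≢y , ¬xy) → x≢y ∘ from-injective ,
    ¬xy ∘ subst₂ (Adj H) (to-from x) (to-from y) ∘ to-adj _ _)
  where open _≃_ e

-- Decidable adjacency cancels the double negation, and looplessness supplies `u ≢ v`.
complement-involutive : ∀ {V} (_≟_ : DecidableEquality V) (G : Graph V) →
                        complement _≟_ (complement _≟_ G) ≃ G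
complement-involutive _ G = mk≃ id id (λ _ → refl) (λ _ → refl)
  (λ u v (u≢v , ¬¬uv) → decidable-stable (adj? G u v) λ ¬uv → ¬¬uv (u≢v , ¬uv))
  (λ u v uv → (λ { refl → loopless G uv }) , λ (_ , ¬uv) → ¬uv uv)

≟Σ : ∀ {k} (ns : Vec ℕ k) → DecidableEquality (Σ[ i ∈ Fin k ] Fin (lookup ns i))
≟Σ _ = Product.≡-dec Fin._≟_ Fin._≟_

-- The disjoint union of complete graphs of orders `ns`, encoded as a complement so that one more
-- complement gives back the complete multipartite graph. Adjacent vertices are distinct and not in
-- different parts.
cliques : ∀ {k} (ns : Vec ℕ k) → Graph (Σ[ i ∈ Fin k ] Fin (lookup ns i))
cliques ns = complement (≟Σ ns) (completeMultipartite ns)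

-- Lets a union of cliques be built up or taken apart one clique at a time.
cliques-∷ : ∀ {k} m (ns : Vec ℕ k) → K m ∪ cliques ns ≃ cliques (m ∷ ns)
cliques-∷ m ns = mk≃
  (λ { (inj₁ x) → zero , x ; (inj₂ (i , x)) → suc i , x })
  (λ { (zero , x) → inj₁ x ; (suc i , x) → inj₂ (i , x) })
  (λ { (zero , _) → refl ; (suc _ , _) → refl })
  (λ { (inj₁ _) → refl ; (inj₂ _) → refl })
  (λ { _ _ (⊎.inj₁ x≢y) → (λ { refl → x≢y refl }) , λ ≢ → ≢ refl
     ; _ _ (⊎.inj₂ (≢ , ¬¬≡)) → (λ { refl → ≢ refl }) , λ ≢′ → ¬¬≡ (≢′ ∘ cong suc) })
  (λ { (zero , _) (zero , _) (≢ , _) → ⊎.inj₁ λ { refl → ≢ refl }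
     ; (zero , _) (suc _ , _) (_ , ¬¬≡) → ⊥-elim (¬¬≡ λ ())
     ; (suc _ , _) (zero , _) (_ , ¬¬≡) → ⊥-elim (¬¬≡ λ ())
     ; (suc _ , _) (suc _ , _) (≢ , ¬¬≡) →
         ⊎.inj₂ ((λ { refl → ≢ refl }) , λ ≢′ → ¬¬≡ (≢′ ∘ Fin.suc-injective)) })

-- Matchings

-- Uniqueness of neighbours instead of a degree bound: it makes sense on every vertex type and
-- passes to induced subgraphs without counting.
record Matching {V : Set} (G : Graph V) : Set where
  constructor mkMatching
  field unique : ∀ {u v w} → Adj G u v → Adj G u w → v ≡ w

open Matching

Matching-resp-≃ : ∀ {V W} {G : Graph V} {H : Graph W} → G ≃ H → Matching H → Matching G
Matching-resp-≃ e matching = mkMatching λ uv uw →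
  to-injective (unique matching (to-adj _ _ uv) (to-adj _ _ uw))
  where open _≃_ e

-- Among at most two values only one differs from `i`. This is the pigeonhole behind the size bound
-- 2 on parts and on dissociation sets.
Fin≤2-distinct : ∀ {n} → n ≤ 2 → {i j k : Fin n} → i ≢ j → i ≢ k → j ≡ k
Fin≤2-distinct _ {zero}     {zero}     {_}        ≢₁ _  = contradiction refl ≢₁
Fin≤2-distinct _ {zero}     {suc _}    {zero}     _  ≢₂ = contradiction refl ≢₂
Fin≤2-distinct (s≤s (s≤s z≤n)) {zero} {suc zero} {suc zero} _ _ = refl
Fin≤2-distinct _ {suc _}    {zero}     {zero}     _  _  = refl
Fin≤2-distinct (s≤s (s≤s z≤n)) {suc zero} {suc zero} {_} ≢₁ _ = contradiction refl ≢₁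
Fin≤2-distinct (s≤s (s≤s z≤n)) {suc zero} {zero} {suc zero} _ ≢₂ = contradiction refl ≢₂

Adj⇒≢ : ∀ {V} (G : Graph V) {u v} → Adj G u v → u ≢ v
Adj⇒≢ G uv refl = loopless G uv

small⇒Matching : ∀ {n} → n ≤ 2 → (G : Graph (Fin n)) → Matching G
small⇒Matching n≤2 G = mkMatching λ uv uw → Fin≤2-distinct n≤2 (Adj⇒≢ G uv) (Adj⇒≢ G uw)

∪-Matching : ∀ {V W} {G : Graph V} {H : Graph W} →
             Matching G → Matching H → Matching (G ∪ H)
∪-Matching mG mH = mkMatching λ
  { (⊎.inj₁ uv) (⊎.inj₁ uw) → cong inj₁ (unique mG uv uw)
  ; (⊎.inj₂ uv) (⊎.inj₂ uw) → cong inj₂ (unique mH uv uw) }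

∙-Matching : ∀ {V} {G : Graph V} m → Matching G → Matching (m ∙ G)
∙-Matching m mG = mkMatching λ { (refl , uv) (refl , uw) → cong (_ ,_) (unique mG uv uw) }

cliques-Matching : ∀ {k} (ns : Vec ℕ k) → (∀ i → lookup ns i ≤ 2) → Matching (cliques ns)
cliques-Matching ns ns≤2 = mkMatching (at-most-one _ _ _)
  where
  at-most-one : ∀ u v w → Adj (cliques ns) u v → Adj (cliques ns) u w → v ≡ w
  at-most-one (i , x) (j , y) (k , z) (≢₁ , ¬¬≡₁) (≢₂ , ¬¬≡₂)
    -- Neighbours share a part, since equality of parts is decidable and the double negation drops.
    -- All three positions then lie in one `Fin` of size at most 2.
    with refl ← decidable-stable (i Fin.≟ j) ¬¬≡₁
       | refl ← decidable-stable (i Fin.≟ k) ¬¬≡₂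
    = cong (i ,_) (Fin≤2-distinct (ns≤2 i) (≢₁ ∘ cong (i ,_)) (≢₂ ∘ cong (i ,_)))

-- For injective `f` this is the induced subgraph on the image, with a vertex type of choice.
-- `G [ D ]` is the pullback along `lookup (elements D)`.
pullback : ∀ {V W : Set} → (W → V) → Graph V → Graph W
pullback f G = record
  { Adj      = λ u v → Adj G (f u) (f v)
  ; adj?     = λ u v → adj? G (f u) (f v)
  ; adj-sym  = adj-sym G
  ; loopless = loopless G
  }

pullback-Matching : ∀ {V W : Set} {f : W → V} → (∀ {x y} → f x ≡ f y → x ≡ y) →
                    (G : Graph V) → Matching G → Matching (pullback f G)
pullback-Matching f-inj G matching = mkMatching λ uv uw → f-inj (unique matching uv uw)

-- Decomposition of a matching into cliques.

split-isolated : ∀ {n} (G : Graph (Fin (suc n))) → (∀ v → ¬ Adj G zero (suc v)) →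
                 K 1 ∪ pullback suc G ≃ G
split-isolated G isolated = mk≃
  (λ { (inj₁ zero) → zero ; (inj₂ v) → suc v })
  (λ { zero → inj₁ zero ; (suc v) → inj₂ v })
  (λ { zero → refl ; (suc _) → refl })
  (λ { (inj₁ zero) → refl ; (inj₂ _) → refl })
  (λ { (inj₁ zero) (inj₁ zero) (⊎.inj₁ ≢) → contradiction refl ≢
     ; _ _ (⊎.inj₂ uv) → uv })
  (λ { zero zero e → ⊥-elim (loopless G e)
     ; zero (suc v) e → ⊥-elim (isolated v e)
     ; (suc v) zero e → ⊥-elim (isolated v (adj-sym G e))
     ; (suc _) (suc _) e → ⊎.inj₂ e })

module _ {n} (v : Fin (suc n)) where

  -- The pair is `zero` and `suc v`; `punchIn v` numbers the remaining vertices.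
  insertPair : Fin 2 ⊎ Fin n → Fin (suc (suc n))
  insertPair (inj₁ zero)       = zero
  insertPair (inj₁ (suc zero)) = suc v
  insertPair (inj₂ i)          = suc (punchIn v i)

  removePair : Fin (suc (suc n)) → Fin 2 ⊎ Fin n
  removePair zero = inj₁ zero
  removePair (suc w) with v Fin.≟ w
  ... | yes _  = inj₁ (suc zero)
  ... | no v≢w = inj₂ (punchOut v≢w)

  insertPair-removePair : ∀ w → insertPair (removePair w) ≡ w
  insertPair-removePair zero = refl
  insertPair-removePair (suc w) with v Fin.≟ w
  ... | yes v≡w = cong suc v≡w
  ... | no v≢w  = cong suc (Fin.punchIn-punchOut v≢w)

  removePair-insertPair : ∀ x → removePair (insertPair x) ≡ x
  removePair-insertPair (inj₁ zero) = refl
  removePair-insertPair (inj₁ (suc zero)) with v Fin.≟ v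
  ... | yes _  = refl
  ... | no v≢v = contradiction refl v≢v
  removePair-insertPair (inj₂ i) with v Fin.≟ punchIn v i
  ... | yes v≡w = contradiction (sym v≡w) (Fin.punchInᵢ≢i v i)
  ... | no v≢w  = cong inj₂ (trans (Fin.punchOut-cong v refl) (Fin.punchOut-punchIn v))

  -- Each end of the edge is the only neighbour of the other, so no edge leaves the pair and it
  -- splits off as a component.
  split-edge : (G : Graph (Fin (suc (suc n)))) → Matching G → Adj G zero (suc v) →
               K 2 ∪ pullback (suc ∘ punchIn v) G ≃ G
  split-edge G matching 0v = ≃-sym (mk≃ removePair insertPair
    removePair-insertPair insertPair-removePair
    -- Writing both vertices as images under `insertPair` lets `reflect` split on the summands
    -- rather than on the test `v Fin.≟ w`.
    (λ u w uw → reflect (removePair u) (removePair w)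
      (subst₂ (Adj G) (sym (insertPair-removePair u)) (sym (insertPair-removePair w)) uw))
    preserve)
    where
    H = K 2 ∪ pullback (suc ∘ punchIn v) G

    only-0v : ∀ {i} → ¬ Adj G zero (suc (punchIn v i))
    only-0v {i} 0i = Fin.punchInᵢ≢i v i (Fin.suc-injective (unique matching 0i 0v))

    only-v0 : ∀ {i} → ¬ Adj G (suc v) (suc (punchIn v i))
    only-v0 vi with () ← unique matching vi (adj-sym G 0v)

    preserve : ∀ x y → Adj H x y → Adj G (insertPair x) (insertPair y)
    preserve (inj₁ zero) (inj₁ zero) (⊎.inj₁ ≢) = contradiction refl ≢
    preserve (inj₁ zero) (inj₁ (suc zero)) _ = 0v
    preserve (inj₁ (suc zero)) (inj₁ zero) _ = adj-sym G 0v
    preserve (inj₁ (suc zero)) (inj₁ (suc zero)) (⊎.inj₁ ≢) = contradiction refl ≢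
    preserve _ _ (⊎.inj₂ e) = e

    reflect : ∀ x y → Adj G (insertPair x) (insertPair y) → Adj H x y
    reflect (inj₁ x) (inj₁ y) e = ⊎.inj₁ λ { refl → loopless G e }
    reflect (inj₁ zero) (inj₂ _) e = ⊥-elim (only-0v e)
    reflect (inj₁ (suc zero)) (inj₂ _) e = ⊥-elim (only-v0 e)
    reflect (inj₂ _) (inj₁ zero) e = ⊥-elim (only-0v (adj-sym G e))
    reflect (inj₂ _) (inj₁ (suc zero)) e = ⊥-elim (only-v0 (adj-sym G e))
    reflect (inj₂ _) (inj₂ _) e = ⊎.inj₂ e

OneOrTwo : ∀ {k} → Vec ℕ k → Set
OneOrTwo ns = ∀ i → 1 ≤ lookup ns i × lookup ns i ≤ 2

-- The order `sum ns ≡ n` is carried through the induction instead of being recovered from the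
-- isomorphism.
IsCliques : ∀ {n} → Graph (Fin n) → Set
IsCliques {n} G = ∃[ k ] Σ[ ns ∈ Vec ℕ k ] (OneOrTwo ns × sum ns ≡ n × G ≃ cliques ns)

cliques-extend : ∀ {m n} {G : Graph (Fin n)} {H : Graph (Fin (m + n))} →
                 1 ≤ m → m ≤ 2 → K m ∪ G ≃ H → IsCliques G → IsCliques H
cliques-extend {m} {G = G} {H} 1≤m m≤2 e (k , ns , 1-2 , sum≡ , e′) =
  suc k , m ∷ ns , (λ { zero → 1≤m , m≤2 ; (suc i) → 1-2 i }) , cong (m +_) sum≡ ,
  ≃-trans (≃-sym e) (≃-trans (∪-cong (≃-refl {G = K m}) e′) (cliques-∷ m ns))

-- Induction on the order: vertex `zero` is isolated or lies on an edge, and in both cases its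
-- component splits off and leaves a smaller matching.
Matching⇒cliques : ∀ n (G : Graph (Fin n)) → Matching G → IsCliques G
Matching⇒cliques zero G _ = 0 , [] , (λ ()) , refl , empty-≃ (λ ()) λ ()
Matching⇒cliques (suc n) G matching with Fin.any? (λ v → adj? G zero (suc v))
Matching⇒cliques (suc n) G matching | no isolated =
  cliques-extend (s≤s z≤n) (s≤s z≤n)
    (split-isolated G λ v e → isolated (v , e))
    (Matching⇒cliques n (pullback suc G) (pullback-Matching Fin.suc-injective G matching))
-- A neighbour of `zero` forces a second vertex, so the order is at least 2 and drops by 2.
Matching⇒cliques (suc (suc n)) G matching | yes (v , 0v) =
  cliques-extend (s≤s z≤n) (s≤s (s≤s z≤n)) (split-edge v G matching 0v)
    (Matching⇒cliques n rest
      (pullback-Matching (Fin.punchIn-injective v _ _ ∘ Fin.suc-injective) G matching))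
  where rest = pullback (suc ∘ punchIn v) G

-- Sorts the cliques by size: `s` counts the parts of size 1 and `t` those of size 2.
cliques≃∪ : ∀ {k} (ns : Vec ℕ k) → OneOrTwo ns →
            ∃[ s ] ∃[ t ] (s + 2 * t ≡ sum ns × cliques ns ≃ (s ∙ K 1) ∪ (t ∙ K 2))
cliques≃∪ [] _ = 0 , 0 , refl , empty-≃
  (λ ()) λ { (inj₁ ()) ; (inj₂ ()) }
cliques≃∪ (m ∷ ns) 1-2 with 1-2 zero | cliques≃∪ ns (1-2 ∘ suc)
cliques≃∪ (1 ∷ ns) 1-2 | _ | s , t , eq , e =
  suc s , t , cong suc eq ,
  ≃-trans (≃-sym (cliques-∷ 1 ns))
  (≃-trans (∪-cong (≃-refl {G = K 1}) e)
  (≃-trans (≃-sym (∪-assoc {G = K 1} {A} {B}))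
           (∪-cong (∙-suc s (K 1)) (≃-refl {G = B}))))
  where A = s ∙ K 1 ; B = t ∙ K 2
cliques≃∪ (2 ∷ ns) 1-2 | _ | s , t , eq , e =
  s , suc t , trans (shift s t) (cong (2 +_) eq) ,
  ≃-trans (≃-sym (cliques-∷ 2 ns))
  -- The copies of `K 2` are swapped to the front to absorb the new one, then swapped back.
  (≃-trans (∪-cong (≃-refl {G = K 2}) (≃-trans e (∪-comm {G = A} {B})))
  (≃-trans (≃-sym (∪-assoc {G = K 2} {B} {A}))
  (≃-trans (∪-cong (∙-suc t (K 2)) (≃-refl {G = A}))
           (∪-comm {G = suc t ∙ K 2} {A}))))
  where
  A = s ∙ K 1 ; B = t ∙ K 2
  shift : ∀ s t → s + 2 * suc t ≡ 2 + (s + 2 * t)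
  shift = solve-∀
cliques≃∪ (0 ∷ ns) 1-2 | () , _ | _
cliques≃∪ (suc (suc (suc _)) ∷ ns) 1-2 | _ , s≤s (s≤s ()) | _

-- Dissociation sets

foldr-⊔-≤ : ∀ {n b} (xs : Vec ℕ n) →
            Vec.foldr′ _⊔_ 0 xs ≤ b ⇔ (∀ i → lookup xs i ≤ b)
foldr-⊔-≤ xs = mk⇔ (⇒ xs) (⇐ xs)
  where
  ⇒ : ∀ {n b} (xs : Vec ℕ n) → Vec.foldr′ _⊔_ 0 xs ≤ b → ∀ i → lookup xs i ≤ b
  ⇒ (x ∷ xs) p zero    = ≤-trans (m≤m⊔n x _) p
  ⇒ (x ∷ xs) p (suc i) = ⇒ xs (≤-trans (m≤n⊔m x _) p) i

  ⇐ : ∀ {n b} (xs : Vec ℕ n) → (∀ i → lookup xs i ≤ b) → Vec.foldr′ _⊔_ 0 xs ≤ b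
  ⇐ []       _ = z≤n
  ⇐ (x ∷ xs) h = ⊔-lub (h zero) (⇐ xs (h ∘ suc))

-- Degrees at most 1 and unique neighbours.

module _ {A : Set} {P : A → Set} (P? : U.Decidable P) where

  count-positive : ∀ {n} (xs : Vec A n) i → P (lookup xs i) → 1 ≤ Vec.count P? xs
  count-positive (x ∷ xs) i p with P? x
  count-positive (x ∷ xs) i       p | yes _ = s≤s z≤n
  count-positive (x ∷ xs) zero    p | no ¬p = contradiction p ¬p
  count-positive (x ∷ xs) (suc i) p | no _  = count-positive xs i p

  -- Two different positions satisfying `P` would contribute 2 to the count.
  count≤1⇒unique : ∀ {n} (xs : Vec A n) → Vec.count P? xs ≤ 1 →
                   ∀ i j → P (lookup xs i) → P (lookup xs j) → i ≡ j
  count≤1⇒unique (x ∷ xs) c i j p q with P? x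
  count≤1⇒unique (x ∷ xs) c zero    zero    p q | _     = refl
  count≤1⇒unique (x ∷ xs) c zero    (suc j) p q | no ¬p = contradiction p ¬p
  count≤1⇒unique (x ∷ xs) c (suc i) zero    p q | no ¬p = contradiction q ¬p
  count≤1⇒unique (x ∷ xs) c (suc i) (suc j) p q | no _  = cong suc (count≤1⇒unique xs c i j p q)
  count≤1⇒unique (x ∷ xs) (s≤s c) zero (suc j) p q | yes _ =
    contradiction (≤-trans (count-positive xs j q) c) λ ()
  count≤1⇒unique (x ∷ xs) (s≤s c) (suc i) j p q | yes _ =
    contradiction (≤-trans (count-positive xs i p) c) λ ()

  none⇒count≡0 : ∀ {n} (xs : Vec A n) → (∀ i → ¬ P (lookup xs i)) → Vec.count P? xs ≡ 0
  none⇒count≡0 []       _ = refl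
  none⇒count≡0 (x ∷ xs) h with P? x
  ... | yes p = contradiction p (h zero)
  ... | no _  = none⇒count≡0 xs (h ∘ suc)

  unique⇒count≤1 : ∀ {n} (xs : Vec A n) →
                   (∀ i j → P (lookup xs i) → P (lookup xs j) → i ≡ j) →
                   Vec.count P? xs ≤ 1
  unique⇒count≤1 []       _ = z≤n
  unique⇒count≤1 (x ∷ xs) h with P? x
  ... | yes p = s≤s (≤-reflexive (none⇒count≡0 xs λ i q →
                  contradiction (h zero (suc i) p q) λ ()))
  ... | no _  = unique⇒count≤1 xs λ i j p q → Fin.suc-injective (h (suc i) (suc j) p q)

module _ {n} (G : Graph (Fin n)) where

  private
    degrees : Vec ℕ n
    degrees = Vec.map (degree G) (Vec.allFin n)

    lookup-degrees : ∀ v → lookup degrees v ≡ degree G v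
    lookup-degrees v =
      trans (lookup-map v (degree G) (Vec.allFin n)) (cong (degree G) (lookup-allFin v))

  -- Entry `v` of `Vec.allFin n` is `v` itself, so the positions counted by the degree of `u` are
  -- exactly its neighbours.
  maxDegree≤1⇒Matching : maxDegree G ≤ 1 → Matching G
  maxDegree≤1⇒Matching p = mkMatching λ {u} {v} {w} uv uw → count≤1⇒unique (adj? G u) (Vec.allFin n)
    (subst (_≤ 1) (lookup-degrees u) (Equivalence.to (foldr-⊔-≤ degrees) p u)) v w
    (subst (Adj G u) (sym (lookup-allFin v)) uv)
    (subst (Adj G u) (sym (lookup-allFin w)) uw)

  Matching⇒maxDegree≤1 : Matching G → maxDegree G ≤ 1
  Matching⇒maxDegree≤1 matching = Equivalence.from (foldr-⊔-≤ degrees) λ u →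
    subst (_≤ 1) (sym (lookup-degrees u)) (unique⇒count≤1 (adj? G u) (Vec.allFin n) λ v w uv uw →
      unique matching (subst (Adj G u) (lookup-allFin v) uv) (subst (Adj G u) (lookup-allFin w) uw))

-- Members of a subset and induced subgraphs.

lookup-elements-∈ : ∀ {n} (D : Subset n) i → lookup (elements D) i Subset.∈ D
lookup-elements-∈ (inside ∷ D)  zero    = here
lookup-elements-∈ (inside ∷ D)  (suc i) = subst (Subset._∈ inside ∷ D)
  (sym (lookup-map i suc (elements D))) (there (lookup-elements-∈ D i))
lookup-elements-∈ (outside ∷ D) i       = subst (Subset._∈ outside ∷ D)
  (sym (lookup-map i suc (elements D))) (there (lookup-elements-∈ D i))

∈⇒lookup-elements : ∀ {n} {D : Subset n} {x} → x Subset.∈ D → ∃[ i ] lookup (elements D) i ≡ x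
∈⇒lookup-elements here = zero , refl
∈⇒lookup-elements {D = inside ∷ D} (there x∈D) with i , refl ← ∈⇒lookup-elements x∈D =
  suc i , lookup-map i suc (elements D)
∈⇒lookup-elements {D = outside ∷ D} (there x∈D) with i , refl ← ∈⇒lookup-elements x∈D =
  i , lookup-map i suc (elements D)

lookup-elements-injective : ∀ {n} (D : Subset n) {i j} →
                            lookup (elements D) i ≡ lookup (elements D) j → i ≡ j
lookup-elements-injective (inside ∷ D) {zero} {zero} _ = refl
lookup-elements-injective (inside ∷ D) {zero} {suc j} p
  with () ← trans p (lookup-map j suc (elements D))
lookup-elements-injective (inside ∷ D) {suc i} {zero} p
  with () ← trans (sym p) (lookup-map i suc (elements D))
lookup-elements-injective (inside ∷ D) {suc i} {suc j} p =
  cong suc (lookup-elements-injective D (Fin.suc-injective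
    (trans (sym (lookup-map i suc (elements D))) (trans p (lookup-map j suc (elements D))))))
lookup-elements-injective (outside ∷ D) {i} {j} p =
  lookup-elements-injective D (Fin.suc-injective
    (trans (sym (lookup-map i suc (elements D))) (trans p (lookup-map j suc (elements D)))))

module _ {n} (G : Graph (Fin n)) where

  Matching⇒Dissociation : Matching G → ∀ D → Dissociation G D
  Matching⇒Dissociation matching D = Matching⇒maxDegree≤1 (G [ D ])
    (pullback-Matching (lookup-elements-injective D) G matching)

  -- Only the full vertex set is used. Its induced subgraph is a renumbering of `G`, so each vertex
  -- is first replaced by its position in the enumeration.
  Dissociation⇒Matching : (∀ D → Dissociation G D) → Matching G
  Dissociation⇒Matching dis = mkMatching at-most-one
    where
    at-most-one : ∀ {u v w} → Adj G u v → Adj G u w → v ≡ w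
    at-most-one {u} {v} {w} uv uw
      with i , refl ← ∈⇒lookup-elements (∈⊤ {x = u})
         | j , refl ← ∈⇒lookup-elements (∈⊤ {x = v})
         | k , refl ← ∈⇒lookup-elements (∈⊤ {x = w})
      = cong (lookup (elements Subset.⊤))
          (unique (maxDegree≤1⇒Matching (G [ Subset.⊤ ]) (dis Subset.⊤)) {i} {j} {k} uv uw)

  small⇒Dissociation : ∀ D → ∣ D ∣ ≤ 2 → Dissociation G D
  small⇒Dissociation D D≤2 = Matching⇒maxDegree≤1 (G [ D ]) (small⇒Matching D≤2 (G [ D ]))

  -- If u had two non-neighbours v and w, then {u, v, w} would be a dissociation set.
  all-small⇒Matching-complement : (∀ D → Dissociation G D → ∣ D ∣ ≤ 2) →
                                  Matching (complement Fin._≟_ G)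
  all-small⇒Matching-complement small =
    mkMatching λ (u≢v , ¬uv) (u≢w , ¬uw) → non-neighbours-≡ u≢v ¬uv u≢w ¬uw
    where
    module _ {u v w} (u≢v : u ≢ v) (¬uv : ¬ Adj G u v) (u≢w : u ≢ w) (¬uw : ¬ Adj G u w) where
      D = ⁅ u ⁆ Subset.∪ (⁅ v ⁆ Subset.∪ ⁅ w ⁆)

      members : ∀ {x} → x Subset.∈ D → x ≡ u ⊎ x ≡ v ⊎ x ≡ w
      members x∈D = Sum.map (x∈⁅y⁆⇒x≡y u)
        (Sum.map (x∈⁅y⁆⇒x≡y v) (x∈⁅y⁆⇒x≡y w) ∘ x∈p∪q⁻ ⁅ v ⁆ ⁅ w ⁆) (x∈p∪q⁻ ⁅ u ⁆ _ x∈D)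

      isolated-u : ∀ {y} → y ≡ u ⊎ y ≡ v ⊎ y ≡ w → ¬ Adj G u y
      isolated-u (inj₁ refl)        = loopless G
      isolated-u (inj₂ (inj₁ refl)) = ¬uv
      isolated-u (inj₂ (inj₂ refl)) = ¬uw

      -- As `u` is isolated within `D`, an edge can only join `v` and `w`, and each of these has at
      -- most the other as neighbour.
      at-most-one : ∀ {x y z} → x ≡ u ⊎ x ≡ v ⊎ x ≡ w → y ≡ u ⊎ y ≡ v ⊎ y ≡ w →
                    z ≡ u ⊎ z ≡ v ⊎ z ≡ w → Adj G x y → Adj G x z → y ≡ z
      at-most-one (inj₁ refl) y∈ _ xy _ = contradiction xy (isolated-u y∈)
      at-most-one x∈ (inj₁ refl) _ xy _ = contradiction (adj-sym G xy) (isolated-u x∈)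
      at-most-one x∈ _ (inj₁ refl) _ xz = contradiction (adj-sym G xz) (isolated-u x∈)
      at-most-one _ (inj₂ (inj₁ refl)) (inj₂ (inj₁ refl)) _ _ = refl
      at-most-one _ (inj₂ (inj₂ refl)) (inj₂ (inj₂ refl)) _ _ = refl
      at-most-one (inj₂ (inj₁ refl)) (inj₂ (inj₁ refl)) _ xy _ = ⊥-elim (loopless G xy)
      at-most-one (inj₂ (inj₁ refl)) _ (inj₂ (inj₁ refl)) _ xz = ⊥-elim (loopless G xz)
      at-most-one (inj₂ (inj₂ refl)) (inj₂ (inj₂ refl)) _ xy _ = ⊥-elim (loopless G xy)
      at-most-one (inj₂ (inj₂ refl)) _ (inj₂ (inj₂ refl)) _ xz = ⊥-elim (loopless G xz)

      dissociation : Dissociation G D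
      dissociation = Matching⇒maxDegree≤1 (G [ D ]) (mkMatching λ {i} {j} {k} ij ik →
        lookup-elements-injective D (at-most-one (members (lookup-elements-∈ D i))
          (members (lookup-elements-∈ D j)) (members (lookup-elements-∈ D k)) ij ik))

      non-neighbours-≡ : v ≡ w
      non-neighbours-≡
        with i , i≡u ← ∈⇒lookup-elements {D = D} (x∈p∪q⁺ (inj₁ (x∈⁅x⁆ u)))
           | j , j≡v ← ∈⇒lookup-elements {D = D} (x∈p∪q⁺ (inj₂ (x∈p∪q⁺ (inj₁ (x∈⁅x⁆ v)))))
           | k , k≡w ← ∈⇒lookup-elements {D = D} (x∈p∪q⁺ (inj₂ (x∈p∪q⁺ (inj₂ (x∈⁅x⁆ w)))))
        = trans (sym j≡v) (trans (cong (lookup (elements D)) j≡k) k≡w)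
        where
        j≡k : j ≡ k
        -- `D` has at most two members and `u` occupies one position, so `v` and `w` share the
        -- other.
        j≡k = Fin≤2-distinct (small D dissociation)
          (λ i≡j → u≢v (trans (sym i≡u) (trans (cong (lookup (elements D)) i≡j) j≡v)))
          (λ i≡k → u≢w (trans (sym i≡u) (trans (cong (lookup (elements D)) i≡k) k≡w)))

-- Of the three pairs in {0, 1, 2} two lie in G or two lie in the complement.
both-Matching⇒small : ∀ {n} (G : Graph (Fin n)) → Matching G →
                      Matching (complement Fin._≟_ G) → n ≤ 2
both-Matching⇒small {0} _ _ _ = z≤n
both-Matching⇒small {1} _ _ _ = s≤s z≤n
both-Matching⇒small {2} _ _ _ = s≤s (s≤s z≤n)
both-Matching⇒small {suc (suc (suc _))} G mG mC with adj? G zero (suc zero)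
-- In either case vertex 2 is joined to both 0 and 1 in whichever of `G` and its complement lacks
-- the edge 01.
... | yes e₀₁ = contradiction
  (unique mC {suc (suc zero)} {zero} {suc zero}
    ((λ ()) , λ e → contradiction (unique mG e₀₁ (adj-sym G e)) λ ())
    ((λ ()) , λ e → contradiction (unique mG (adj-sym G e₀₁) (adj-sym G e)) λ ()))
  λ ()
... | no ¬e₀₁ = contradiction
  (unique mG {suc (suc zero)} {zero} {suc zero}
    (decidable-stable (adj? G _ _) λ ¬e₂₀ → contradiction
      (unique mC {zero} {suc zero} {suc (suc zero)} ((λ ()) , ¬e₀₁) ((λ ()) , ¬e₂₀ ∘ adj-sym G)) λ ())
    (decidable-stable (adj? G _ _) λ ¬e₂₁ → contradiction
      (unique mC {suc zero} {zero} {suc (suc zero)}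
        ((λ ()) , ¬e₀₁ ∘ adj-sym G) ((λ ()) , ¬e₂₁ ∘ adj-sym G)) λ ()))
  λ ()

-- The complement of `G [ D ]` is induced in the complement of `G`, hence a matching. As `G [ D ]`
-- is one too, its order is at most 2.
Matching-complement⇒small : ∀ {n} (G : Graph (Fin n)) → Matching (complement Fin._≟_ G) →
                            ∀ D → Dissociation G D → ∣ D ∣ ≤ 2
Matching-complement⇒small G matching D dis = both-Matching⇒small (G [ D ])
  (maxDegree≤1⇒Matching (G [ D ]) dis)
  (mkMatching λ (i≢j , ¬ij) (i≢k , ¬ik) → lookup-elements-injective D
    (unique matching (i≢j ∘ lookup-elements-injective D , ¬ij)
                     (i≢k ∘ lookup-elements-injective D , ¬ik)))

-- Counting

filter-map : ∀ {A B : Set} {P : B → Set} (P? : U.Decidable P) (f : A → B) xs →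
             filter P? (List.map f xs) ≡ List.map f (filter (P? ∘ f) xs)
filter-map P? f [] = refl
filter-map P? f (x ∷ xs) with does (P? (f x))
... | true  = cong (f x ∷_) (filter-map P? f xs)
... | false = filter-map P? f xs

-- `d G` is by definition `# (dissociation? G)`, so both bounds compare values of this one function.
# : ∀ {n} {P : Subset n → Set} → U.Decidable P → ℕ
# {n} P? = length (filter P? (subsets n))

∈-subsets : ∀ {n} (D : Subset n) → D List.∈ subsets n
∈-subsets []                    = Any.here refl
∈-subsets (inside ∷ D)          = ∈-++⁺ˡ (∈-map⁺ (inside ∷_) (∈-subsets D))
∈-subsets {suc n} (outside ∷ D) =
  ∈-++⁺ʳ (List.map (inside ∷_) (subsets n)) (∈-map⁺ (outside ∷_) (∈-subsets D))

-- Filtering one list by a stronger predicate gives a sublist, and a sublist of full length is the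
-- whole list. Hence equal counts force equivalent predicates, which is how the equality cases
-- become statements about every subset.
module _ {n} {P Q : Subset n → Set} (P? : U.Decidable P) (Q? : U.Decidable Q)
         (P⊆Q : ∀ D → P D → Q D) where

  private
    sublist : filter P? (subsets n) ⊆ filter Q? (subsets n)
    sublist = filter⁺ P? Q? (λ { refl → P⊆Q _ }) (⊆-refl {x = subsets n})

  #-mono : # P? ≤ # Q?
  #-mono = length-mono-≤ sublist

  #-≡⇒⊇ : # P? ≡ # Q? → ∀ D → Q D → P D
  #-≡⇒⊇ eq D q = proj₂ (∈-filter⁻ P? {xs = subsets n}
    (subst (D List.∈_) (sym (≋⇒≡ (to-≋ eq sublist))) (∈-filter⁺ Q? (∈-subsets D) q)))

  ⊇⇒#-≡ : (∀ D → Q D → P D) → # P? ≡ # Q?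
  ⊇⇒#-≡ Q⊆P = cong length (filter-≐ P? Q? ((λ {D} → P⊆Q D) , λ {D} → Q⊆P D) (subsets n))

#-suc : ∀ {n} {P : Subset (suc n) → Set} (P? : U.Decidable P) →
        # P? ≡ # (P? ∘ (inside ∷_)) + # (P? ∘ (outside ∷_))
#-suc {n} P? = begin
  length (filter P? (ins ++ outs))
    ≡⟨ cong length (filter-++ P? ins outs) ⟩
  length (filter P? ins ++ filter P? outs)
    ≡⟨ length-++ (filter P? ins) ⟩
  length (filter P? ins) + length (filter P? outs)
    ≡⟨ cong₂ (λ xs ys → length xs + length ys)
         (filter-map P? (inside ∷_) (subsets n)) (filter-map P? (outside ∷_) (subsets n)) ⟩
  length (List.map (inside ∷_) (filter (P? ∘ (inside ∷_)) (subsets n)))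
    + length (List.map (outside ∷_) (filter (P? ∘ (outside ∷_)) (subsets n)))
    ≡⟨ cong₂ _+_ (length-map (inside ∷_) (filter (P? ∘ (inside ∷_)) (subsets n)))
         (length-map (outside ∷_) (filter (P? ∘ (outside ∷_)) (subsets n))) ⟩
  # (P? ∘ (inside ∷_)) + # (P? ∘ (outside ∷_)) ∎
  where
  open ≡-Reasoning
  ins  = List.map (inside ∷_) (subsets n)
  outs = List.map (outside ∷_) (subsets n)

-- The trivial predicate makes the number of all subsets a value of `#` as well.
any? : ∀ {n} → U.Decidable {A = Subset n} (λ _ → ⊤)
any? _ = yes tt

#-any : ∀ n → # (any? {n}) ≡ 2 ^ n
#-any zero    = refl
#-any (suc n) = trans (#-suc (any? {suc n}))
  (cong₂ _+_ (#-any n) (trans (#-any n) (sym (+-identityʳ _))))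

∣_∣≤?_ : ∀ {n} (D : Subset n) k → Dec (∣ D ∣ ≤ k)
∣ D ∣≤? k = ∣ D ∣ ≤? k

-- This is the sum of the binomial coefficients C(n,0), ..., C(n,k).
#≤ : ℕ → ℕ → ℕ
#≤ k n = # {n} (∣_∣≤? k)

-- Pascal's rule, summed: split the subsets by whether they contain the first element.
#≤-suc : ∀ k n → #≤ (suc k) (suc n) ≡ #≤ k n + #≤ (suc k) n
#≤-suc k n = trans (#-suc {n} (∣_∣≤? suc k)) (cong (_+ #≤ (suc k) n)
  -- The tests `suc ∣ D ∣ ≤ suc k` and `∣ D ∣ ≤ k` are equivalent but not the same decision
  -- procedure, so their counts are compared.
  (⊇⇒#-≡ {n} (λ D → suc ∣ D ∣ ≤? suc k) (∣_∣≤? k) (λ { _ (s≤s p) → p }) (λ _ → s≤s)))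

#≤0 : ∀ n → #≤ 0 n ≡ 1
#≤0 zero    = refl
#≤0 (suc n) = trans (#-suc {n} (∣_∣≤? 0)) (cong₂ _+_
  (cong length (filter-none (λ D → suc ∣ D ∣ ≤? 0) {xs = subsets n} (All.universal (λ _ ()) _)))
  (#≤0 n))

#≤1 : ∀ n → #≤ 1 n ≡ suc n
#≤1 zero    = refl
#≤1 (suc n) = trans (#≤-suc 0 n) (cong₂ _+_ (#≤0 n) (#≤1 n))

-- Doubling keeps division out of the induction; each step adds `2 * suc n` to both sides.
#≤2-double : ∀ n → #≤ 2 n * 2 ≡ n ^ 2 + n + 2
#≤2-double zero    = refl
#≤2-double (suc n) = begin
  #≤ 2 (suc n) * 2              ≡⟨ cong (_* 2) (#≤-suc 1 n) ⟩
  (#≤ 1 n + #≤ 2 n) * 2         ≡⟨ cong (λ m → (m + #≤ 2 n) * 2) (#≤1 n) ⟩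
  (suc n + #≤ 2 n) * 2          ≡⟨ *-distribʳ-+ 2 (suc n) (#≤ 2 n) ⟩
  suc n * 2 + #≤ 2 n * 2        ≡⟨ cong (suc n * 2 +_) (#≤2-double n) ⟩
  suc n * 2 + (n ^ 2 + n + 2)   ≡⟨ expand n ⟩
  suc n ^ 2 + suc n + 2         ∎
  where
  open ≡-Reasoning
  -- Squares are unfolded because the solver does not accept _^_ here.
  expand : ∀ n → suc n * 2 + (n * (n * 1) + n + 2) ≡ suc n * (suc n * 1) + suc n + 2
  expand = solve-∀

-- The numerator is twice a count, so the integer division is exact.
#≤2 : ∀ n → (n ^ 2 + n + 2) / 2 ≡ #≤ 2 n
#≤2 n = trans (cong (_/ 2) (sym (#≤2-double n))) (m*n/n≡m (#≤ 2 n) 2)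

-- Bounds and extremal graphs.

theorem2p1 : (n : ℕ) → 1 ≤ n → (G : Graph (Fin n)) →
    ((n ^ 2 + n + 2) / 2 ≤ d G × d G ≤ 2 ^ n)
    × (((n ^ 2 + n + 2) / 2 ≡ d G) ⇔
       (∃[ k ] Σ[ ns ∈ Vec ℕ k ]
          ((∀ i → 1 ≤ lookup ns i × lookup ns i ≤ 2)
           × sum ns ≡ n
           × G ≅ completeMultipartite ns)))
    × ((d G ≡ 2 ^ n) ⇔
       (∃[ s ] ∃[ t ] (s + 2 * t ≡ n × G ≅ (s ∙ K 1) ∪ (t ∙ K 2))))
theorem2p1 n _ G =
  ( subst (_≤ d G) (sym (#≤2 n)) (#-mono (∣_∣≤? 2) (dissociation? G) (small⇒Dissociation G))
  , subst (d G ≤_) (#-any n) (#-mono (dissociation? G) any? _)) ,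
  mk⇔ lower⇒ lower⇐ ,
  mk⇔ upper⇒ upper⇐
  where
  lower⇒ : (n ^ 2 + n + 2) / 2 ≡ d G → _
  lower⇒ eq
    -- Equal counts mean that every dissociation set has at most two members, so the complement of
    -- `G` is a matching.
    with k , ns , 1-2 , sum≡ , e ← Matching⇒cliques n (complement Fin._≟_ G)
      (all-small⇒Matching-complement G
        (#-≡⇒⊇ (∣_∣≤? 2) (dissociation? G) (small⇒Dissociation G) (trans (sym (#≤2 n)) eq)))
    -- or
    = k , ns , 1-2 , sum≡ , ≃⇒≅
        (≃-trans (≃-sym (complement-involutive Fin._≟_ G))
          (≃-trans (complement-cong Fin._≟_ (≟Σ ns) e)
            (complement-involutive (≟Σ ns) (completeMultipartite ns))))

  lower⇐ : _ → (n ^ 2 + n + 2) / 2 ≡ d G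
  lower⇐ (k , ns , 1-2 , _ , e) = trans (#≤2 n)
    (⊇⇒#-≡ (∣_∣≤? 2) (dissociation? G) (small⇒Dissociation G)
      (Matching-complement⇒small G
        (Matching-resp-≃ (complement-cong Fin._≟_ (≟Σ ns) {G} {completeMultipartite ns} (≅⇒≃ e))
          (cliques-Matching ns (proj₂ ∘ 1-2)))))

  upper⇒ : d G ≡ 2 ^ n → _
  upper⇒ eq
    with k , ns , 1-2 , sum≡ , e ← Matching⇒cliques n G
      (Dissociation⇒Matching G λ D →
        #-≡⇒⊇ (dissociation? G) any? _ (trans eq (sym (#-any n))) D tt)
    with s , t , eq′ , e′ ← cliques≃∪ ns 1-2
    = s , t , trans eq′ sum≡ , ≃⇒≅ (≃-trans e e′)

  upper⇐ : _ → d G ≡ 2 ^ n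
  upper⇐ (s , t , _ , e) = trans
    (⊇⇒#-≡ (dissociation? G) any? _ λ D _ → Matching⇒Dissociation G
      (Matching-resp-≃ (≅⇒≃ e)
        (∪-Matching (∙-Matching s (small⇒Matching (s≤s z≤n) (K 1)))
                    (∙-Matching t (small⇒Matching ≤-refl (K 2))))) D)
    (#-any n)
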